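{- Let $\lambda/\mu$ be an edgewise connected skew diagram whose boxes have contents $c_{\min}, c_{\min}+1,\ldots,c_{\max}$, and let $i$ be an integer with $c_{\min}\le i<c_{\max}$. Let $\Pi$ be an outside decomposition of $\lambda/\mu$, and let $\Pi'=\omega_i(\Pi)$ be the outside decomposition obtained from $\Pi$ by the twist transformation $\omega_i$. Then exactly one of the following holds: (a) $i\notin \mathrm{Term}(\Pi)$, $i+1\notin \mathrm{Init}(\Pi)$, $\mathrm{Init}(\Pi')=\mathrm{Init}(\Pi)\cup\{i+1\}$ and $\mathrm{Term}(\Pi')=\mathrm{Term}(\Pi)\cup\{i\}$; (b) $i\in \mathrm{Term}(\Pi)$, $i+1\in \mathrm{Init}(\Pi)$, $\mathrm{Init}(\Pi')=\mathrm{Init}(\Pi)\setminus\{i+1\}$ and $\mathrm{Term}(\Pi')=\mathrm{Term}(\Pi)\setminus\{i\}$; (c) $i\in \mathrm{Term}(\Pi)$, $i+1\notin \mathrm{Init}(\Pi)$, $\mathrm{Init}(\Pi')=\mathrm{Init}(\Pi)$ and $\mathrm{Term}(\Pi')=\mathrm{Term}(\Pi)$; (d) $i\notin \mathrm{Term}(\Pi)$, $i+1\in \mathrm{Init}(\Pi)$, $\mathrm{Init}(\Pi')=\mathrm{Init}(\Pi)$ and $\mathrm{Term}(\Pi')=\mathrm{Term}(\Pi)$.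
   Context: Diagrams use English convention: box $(r,c)$ is in row $r$ from the top and column $c$ from the left; its content is $c-r$. A skew diagram $\lambda/\mu$ ($\mu\subseteq\lambda$ partitions) is the set of boxes of $\lambda$ not in $\mu$; it is edgewise connected if its boxes are connected via shared edges. A border strip is an edgewise connected skew diagram containing no $2\times 2$ block of boxes; its boxes have consecutive contents, each box (except the last) being followed by the box of next content which lies either directly above it ("up") or directly to its right ("right"). An outside decomposition of $\lambda/\mu$ is a partition of its boxes into pairwise disjoint border strips such that each strip has its starting box (smallest content) on the left or bottom perimeter of the diagram and its ending box (largest content) on the right or top perimeter. For a strip $\theta$, $p(\theta)$ and $q(\theta)$ denote the contents of its initial and terminal boxes; for $\Pi=(\theta_1,\ldots,\theta_m)$, $\mathrm{Init}(\Pi)=\{p(\theta_1),\ldots,p(\theta_m)\}$ and $\mathrm{Term}(\Pi)=\{q(\theta_1),\ldots,q(\theta_m)\}$. Fact (Chen–Yan–Yang): for edgewise connected $\lambda/\mu$, outside decompositions $\Pi$ are in bijection with border strips $\phi$ with boxes of contents $c_{\min},\ldots,c_{\max}$ (the cutting strip of $\Pi$), where for each $j$ with $c_{\min}\le j<c_{\max}$, the box of content $j+1$ of $\phi$ lies above (resp. to the right of) the box of content $j$ of $\phi$ iff in every strip of $\Pi$ containing boxes of contents $j$ and $j+1$, the box of content $j+1$ lies above (resp. to the right of) the box of content $j$. The twist transformation $\omega_i$ maps $\Pi$ to the outside decomposition whose cutting strip is obtained from that of $\Pi$ by switching the relative position of its boxes of contents $i$ and $i+1$ (up $\leftrightarrow$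 right), keeping all other relative positions.
   Formalization: When no strip of Π contains boxes of both contents j and j+1, the stated rule for the cutting strip is contradictory (vacuously up and right); there the cutting strip is taken to go in the direction opposite to the adjacency of the two boxes in the diagram, as the bijection forces. -}

module Defs where

open import Data.Fin.Base using (Fin)
open import Data.Integer.Base as ℤ using (ℤ; +_; 1ℤ)
open import Data.Nat.Base as ℕ using (ℕ; suc)
open import Data.Product using (∃; ∃!; ∃₂; _×_; _,_)
open import Data.Sum.Base using (_⊎_)
open import Data.Vec.Base using (Vec; lookup)
open import Function.Bundles using (_⇔_)
open import Level using (0ℓ)
open import Relation.Binary.Construct.Closure.ReflexiveTransitive using (Star)
open import Relation.Binary.Core using (Rel)
open import Relation.Binary.PropositionalEquality.Core using (_≡_; _≢_)
open import Relation.Nullary.Negation.Core using (¬_)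
open import Relation.Unary using (Pred)

-- Rows and columns are numbered from 0; contents are the same as when both
-- are numbered from 1.
record Box : Set where
  constructor box
  field
    row col : ℕ
open Box public

content : Box → ℤ
content x = + col x ℤ.- + row x

Above : Rel Box 0ℓ
Above y x = row x ≡ suc (row y) × col y ≡ col x

RightOf : Rel Box 0ℓ
RightOf y x = row y ≡ row x × col y ≡ suc (col x)

ShareEdge : Rel Box 0ℓ
ShareEdge x y = (Above y x ⊎ Above x y) ⊎ (RightOf y x ⊎ RightOf x y)

record Partition : Set where
  field
    part           : ℕ → ℕ
    decreasing     : ∀ r → part (suc r) ℕ.≤ part r
    eventuallyZero : ∃ λ n → ∀ r → n ℕ.≤ r → part r ≡ 0
open Partition public

record SkewDiagram : Set where
  field
    outer inner : Partition
    inner⊆outer : ∀ r → part inner r ℕ.≤ part outer r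
open SkewDiagram public

infix 4 _∈ᵈ_

_∈ᵈ_ : Box → SkewDiagram → Set
x ∈ᵈ D = part (inner D) (row x) ℕ.≤ col x × col x ℕ.< part (outer D) (row x)

EdgewiseConnected : SkewDiagram → Set
EdgewiseConnected D =
  ∀ {x y} → x ∈ᵈ D → y ∈ᵈ D →
  Star (λ u v → u ∈ᵈ D × v ∈ᵈ D × ShareEdge u v) x y

Contains2×2 : SkewDiagram → Set
Contains2×2 D = ∃₂ λ r c →
  box r c ∈ᵈ D × box r (suc c) ∈ᵈ D ×
  box (suc r) c ∈ᵈ D × box (suc r) (suc c) ∈ᵈ D

HasContent : SkewDiagram → ℤ → Set
HasContent D j = ∃ λ x → x ∈ᵈ D × content x ≡ j

HasContents[_,_] : ℤ → ℤ → SkewDiagram → Set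
HasContents[ cmin , cmax ] D =
  ∀ j → HasContent D j ⇔ (cmin ℤ.≤ j × j ℤ.≤ cmax)

record IsBorderStrip (θ : SkewDiagram) : Set where
  field
    nonempty  : ∃ λ x → x ∈ᵈ θ
    connected : EdgewiseConnected θ
    no2×2     : ¬ Contains2×2 θ

IsInitial : SkewDiagram → Pred Box 0ℓ
IsInitial θ x = x ∈ᵈ θ × (∀ y → y ∈ᵈ θ → content x ℤ.≤ content y)

IsTerminal : SkewDiagram → Pred Box 0ℓ
IsTerminal θ x = x ∈ᵈ θ × (∀ y → y ∈ᵈ θ → content y ℤ.≤ content x)

GoesUp : SkewDiagram → ℤ → Set
GoesUp θ j = ∃₂ λ x y → x ∈ᵈ θ × y ∈ᵈ θ ×
  content x ≡ j × content y ≡ j ℤ.+ 1ℤ × Above y x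

GoesRight : SkewDiagram → ℤ → Set
GoesRight θ j = ∃₂ λ x y → x ∈ᵈ θ × y ∈ᵈ θ ×
  content x ≡ j × content y ≡ j ℤ.+ 1ℤ × RightOf y x

OnLeft OnBottom OnRight OnTop : SkewDiagram → Pred Box 0ℓ
OnLeft   D x = x ∈ᵈ D × (∀ y → RightOf x y → ¬ (y ∈ᵈ D))
OnBottom D x = x ∈ᵈ D × (∀ y → Above x y → ¬ (y ∈ᵈ D))
OnRight  D x = x ∈ᵈ D × (∀ y → RightOf y x → ¬ (y ∈ᵈ D))
OnTop    D x = x ∈ᵈ D × (∀ y → Above y x → ¬ (y ∈ᵈ D))

record OutsideDecomposition (D : SkewDiagram) : Set where
  field
    size          : ℕ
    strip         : Fin size → SkewDiagram
    isBorderStrip : ∀ k → IsBorderStrip (strip k)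
    within        : ∀ k x → x ∈ᵈ strip k → x ∈ᵈ D
    covers        : ∀ x → x ∈ᵈ D → ∃ λ k → x ∈ᵈ strip k
    disjoint      : ∀ k l x → x ∈ᵈ strip k → x ∈ᵈ strip l → k ≡ l
    starts        : ∀ k x → IsInitial (strip k) x → OnLeft D x ⊎ OnBottom D x
    ends          : ∀ k x → IsTerminal (strip k) x → OnRight D x ⊎ OnTop D x
open OutsideDecomposition public

Init : ∀ {D} → OutsideDecomposition D → Pred ℤ 0ℓ
Init Π p = ∃₂ λ k x → IsInitial (strip Π k) x × content x ≡ p

Term : ∀ {D} → OutsideDecomposition D → Pred ℤ 0ℓ
Term Π q = ∃₂ λ k x → IsTerminal (strip Π k) x × content x ≡ q

Meets : SkewDiagram → ℤ → Set
Meets θ j = HasContent θ j × HasContent θ (j ℤ.+ 1ℤ)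

-- The requirement "φ goes up (right) at j iff every strip of Π containing
-- boxes of contents j and j+1 goes up (right) there" determines φ only when
-- some strip contains such boxes.  Otherwise D has a single box x of content j
-- and a single box y of content j+1, they share an edge, and Π separates them.
-- The decomposition joining x to y has the cutting strip in which j+1 is placed
-- relative to j as y is to x, so, the correspondence between decompositions
-- and cutting strips being bijective, φ takes the other direction at j.
record IsCuttingStrip {D : SkewDiagram} (cmin cmax : ℤ)
                      (Π : OutsideDecomposition D) (φ : SkewDiagram) : Set where
  field
    isBorderStrip : IsBorderStrip φ
    contents      : HasContents[ cmin , cmax ] φ
    up            : ∀ j → cmin ℤ.≤ j → j ℤ.< cmax →
                    (∃ λ k → Meets (strip Π k) j) →
                    GoesUp φ j ⇔ (∀ k → Meets (strip Π k) j → GoesUp (strip Π k) j)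
    right         : ∀ j → cmin ℤ.≤ j → j ℤ.< cmax →
                    (∃ λ k → Meets (strip Π k) j) →
                    GoesRight φ j ⇔ (∀ k → Meets (strip Π k) j → GoesRight (strip Π k) j)
    separated     : ∀ j → cmin ℤ.≤ j → j ℤ.< cmax →
                    ¬ (∃ λ k → Meets (strip Π k) j) →
                    (GoesUp φ j ⇔ GoesRight D j) × (GoesRight φ j ⇔ GoesUp D j)

record IsSwitch (i : ℤ) (φ φ′ : SkewDiagram) : Set where
  field
    up-at-i    : GoesUp φ′ i ⇔ GoesRight φ i
    right-at-i : GoesRight φ′ i ⇔ GoesUp φ i
    up-else    : ∀ j → j ≢ i → GoesUp φ′ j ⇔ GoesUp φ j
    right-else : ∀ j → j ≢ i → GoesRight φ′ j ⇔ GoesRight φ j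

-- The graph of ωᵢ: Π′ = ωᵢ(Π).  Cutting strips matter only up to translation
-- along the diagonal, so φ and φ′ are existentially quantified.
IsTwist : {D : SkewDiagram} (cmin cmax i : ℤ) (Π Π′ : OutsideDecomposition D) → Set
IsTwist cmin cmax i Π Π′ = ∃₂ λ φ φ′ →
  IsCuttingStrip cmin cmax Π φ × IsCuttingStrip cmin cmax Π′ φ′ × IsSwitch i φ φ′

ExactlyOne : ∀ {n} → Vec Set n → Set
ExactlyOne Ps = ∃! _≡_ (λ k → lookup Ps k)

{-# OPTIONS --safe #-}
-- Suppose the cutting strip of Π goes in direction d (up or right) at content j.
-- Then Π links a box x of content j to its neighbour in direction d whenever
-- both boxes lie in D, and x is linked to nothing else.  Hence j ∈ Term Π iff
-- some box of content j has no neighbour in D in direction d, and j + 1 ∈ Init Π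
-- iff some box of content j + 1 has no neighbour in D in the reverse direction.
-- So the twist at i only affects whether i is terminal and i + 1 is initial.
-- By convexity of skew diagrams, exactly one of the following two holds: some
-- box of content i has nothing in direction d, or some box of content i + 1 is
-- not preceded in the other direction.  That is, exactly one of i ∈ Term Π and
-- i + 1 ∈ Init Π′ holds, and likewise with Π and Π′ exchanged; the four
-- combinations are the four cases.
module Submission where

open import Defs
open import Data.Empty using (⊥; ⊥-elim)
open import Data.Fin.Base using (zero; suc)
import Data.Fin.Properties as Fin
open import Data.Integer.Base using (ℤ; _+_; _-_; _≤_; _<_; 1ℤ; +_; pred)
import Data.Integer.Properties as ℤ
open import Data.Integer.Tactic.RingSolver using (solve-∀)
open import Data.Nat.Base as ℕ using (ℕ; zero; suc; s≤s)
import Data.Nat.Properties as ℕ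
open import Data.Product using (∃; ∃₂; _×_; _,_; proj₁; proj₂)
open import Data.Sum.Base using (_⊎_; inj₁; inj₂; [_,_]′; swap)
open import Data.Vec.Base using (Vec; lookup; _∷_; [])
open import Function.Base using (id; _∘_)
open import Function.Bundles using (_⇔_; mk⇔; module Equivalence)
open import Level using (0ℓ)
open import Relation.Binary.Construct.Closure.ReflexiveTransitive using (Star; ε; _◅_)
open import Relation.Binary.Core using (Rel)
open import Relation.Binary.Definitions using (tri<; tri≈; tri>)
open import Relation.Binary.PropositionalEquality using (_≡_; _≢_; refl; sym; trans; cong; subst)
open import Relation.Nullary using (¬_; Dec; yes; no; contradiction)
open import Relation.Nullary.Decidable using (_×-dec_)
open import Relation.Unary using (_∈_; _∉_; _≐_; _∪_; _∖_; ｛_｝; Pred)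

open Equivalence using (to; from)

private variable
  D θ φ φ′ : SkewDiagram
  x y z u v : Box
  i j : ℤ

-- Successors of integers.

i<i+1 : ∀ i → i < i + 1ℤ
i<i+1 i = subst (i <_) (ℤ.+-comm 1ℤ i) (ℤ.suc[i]≤j⇒i<j ℤ.≤-refl)

i<j⇒i+1≤j : i < j → i + 1ℤ ≤ j
i<j⇒i+1≤j {i} i<j = subst (_≤ _) (ℤ.+-comm 1ℤ i) (ℤ.i<j⇒suc[i]≤j i<j)

pred+1 : ∀ i → pred i + 1ℤ ≡ i
pred+1 i = trans (ℤ.+-comm (pred i) 1ℤ) (ℤ.suc-pred i)

pred[i+1] : ∀ i → pred (i + 1ℤ) ≡ i
pred[i+1] i = trans (cong pred (ℤ.+-comm i 1ℤ)) (ℤ.pred-suc i)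

i<j+1⇒i≤j : i < j + 1ℤ → i ≤ j
i<j+1⇒i≤j {i} {j} i<j+1 = subst (i ≤_) (pred[i+1] j) (ℤ.i<j⇒i≤pred[j] i<j+1)

+1-injective : i + 1ℤ ≡ j + 1ℤ → i ≡ j
+1-injective {i} {j} eq =
  trans (sym (pred[i+1] i)) (trans (cong pred eq) (pred[i+1] j))

-- The two directions, treated uniformly.

data Direction : Set where
  north east : Direction

flip : Direction → Direction
flip north = east
flip east  = north

Next : Direction → Rel Box 0ℓ
Next north = Above
Next east  = RightOf

Goes : Direction → SkewDiagram → ℤ → Set
Goes d θ j = ∃₂ λ x y → x ∈ᵈ θ × y ∈ᵈ θ ×
  content x ≡ j × content y ≡ j + 1ℤ × Next d y x

-- For `north` these are the top and bottom perimeters, for `east` the right and left ones.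
OnEnd OnStart : Direction → SkewDiagram → Pred Box 0ℓ
OnEnd   d D x = x ∈ᵈ D × (∀ y → Next d y x → ¬ (y ∈ᵈ D))
OnStart d D y = y ∈ᵈ D × (∀ x → Next d y x → ¬ (x ∈ᵈ D))

HasEnd HasStart : Direction → SkewDiagram → Pred ℤ 0ℓ
HasEnd   d D j = ∃ λ x → OnEnd d D x × content x ≡ j
HasStart d D j = ∃ λ y → OnStart d D y × content y ≡ j

-- Contents and the relative position of boxes.

Next-content : ∀ d → Next d y x → content y ≡ content x + 1ℤ
Next-content {y} north (refl , refl) = lemma (+ col y) (+ row y)
  where
  lemma : ∀ c r → c - r ≡ c - (1ℤ + r) + 1ℤ
  lemma = solve-∀
Next-content {x = x} east (refl , refl) = lemma (+ col x) (+ row x)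
  where
  lemma : ∀ c r → 1ℤ + c - r ≡ c - r + 1ℤ
  lemma = solve-∀

Next-functional : ∀ d → Next d y x → Next d z x → y ≡ z
Next-functional north (refl , refl) (refl , refl) = refl
Next-functional east  (refl , refl) (refl , refl) = refl

Next-injective : ∀ d → Next d y x → Next d y z → x ≡ z
Next-injective north (refl , refl) (refl , refl) = refl
Next-injective east  (refl , refl) (refl , refl) = refl

-- Rearranged without subtraction, so that positions can be compared in `ℕ`.
content-≡⇒ : content x ≡ content y → col x ℕ.+ row y ≡ col y ℕ.+ row x
content-≡⇒ {box r c} {box s t} eq = ℤ.+-injective
  (trans (lemma (+ c) (+ r) (+ s))
    (trans (cong (_+ (+ r + + s)) eq) (lemma′ (+ t) (+ r) (+ s))))
  where
  lemma : ∀ c r s → c + s ≡ c - r + (r + s)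
  lemma = solve-∀
  lemma′ : ∀ t r s → t - s + (r + s) ≡ t + r
  lemma′ = solve-∀

content-+1⇒ : content y ≡ content x + 1ℤ → col y ℕ.+ row x ≡ suc (col x) ℕ.+ row y
content-+1⇒ {y} {x} eq =
  content-≡⇒ {y} {box (row x) (suc (col x))}
    (trans eq (sym (Next-content {x = x} east (refl , refl))))

private
  <⇒< : ∀ {c t r s} → c ℕ.+ s ≡ t ℕ.+ r → r ℕ.< s → c ℕ.< t
  <⇒< {c} {t} {r} {s} eq r<s = ℕ.+-cancelʳ-< r c t
    (ℕ.<-≤-trans (ℕ.+-monoʳ-< c r<s) (ℕ.≤-reflexive eq))

  ≤⇒≤ : ∀ {c t r s} → c ℕ.+ s ≡ t ℕ.+ r → r ℕ.≤ s → c ℕ.≤ t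
  ≤⇒≤ {c} {t} {r} {s} eq r≤s = ℕ.+-cancelʳ-≤ r c t
    (ℕ.≤-trans (ℕ.+-monoʳ-≤ c r≤s) (ℕ.≤-reflexive eq))

infix 4 _⊑_ _⊏_

_⊑_ _⊏_ : Rel Box 0ℓ
x ⊑ y = row x ℕ.≤ row y × col x ℕ.≤ col y
x ⊏ y = row x ℕ.< row y × col x ℕ.< col y

compare-diagonal : content x ≡ content y → x ⊏ y ⊎ x ≡ y ⊎ y ⊏ x
compare-diagonal {x} {y} eq with ℕ.<-cmp (row x) (row y)
... | tri< r<s _ _ = inj₁ (r<s , <⇒< (content-≡⇒ {x} {y} eq) r<s)
... | tri> _ _ s<r = inj₂ (inj₂ (s<r , <⇒< (content-≡⇒ {y} {x} (sym eq)) s<r))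
... | tri≈ _ refl _ =
  inj₂ (inj₁ (cong (box (row x)) (ℕ.+-cancelʳ-≡ (row x) _ _ (content-≡⇒ {x} {y} eq))))

-- In the first case the boxes above `x` and below `y` lie between `x` and `y`, in the second those
-- right of `x` and left of `y`; convexity applies to them.
compare-adjacent : content y ≡ content x + 1ℤ →
  (row y ℕ.< row x × col y ℕ.≤ col x) ⊎ (row x ℕ.≤ row y × col x ℕ.< col y)
compare-adjacent {y} {x} eq with ℕ.<-≤-connex (row y) (row x)
... | inj₁ s<r = inj₁ (s<r , ℕ.s≤s⁻¹ (<⇒< (content-+1⇒ {y} {x} eq) s<r))
... | inj₂ r≤s = inj₂ (r≤s , ≤⇒≤ (sym (content-+1⇒ {y} {x} eq)) r≤s)

-- Convexity of skew diagrams.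

antitone : ∀ P {r s} → r ℕ.≤ s → part P s ℕ.≤ part P r
antitone P r≤s = go (ℕ.≤⇒≤′ r≤s)
  where
  go : ∀ {r s} → r ℕ.≤′ s → part P s ℕ.≤ part P r
  go ℕ.≤′-refl       = ℕ.≤-refl
  go (ℕ.≤′-step r≤s) = ℕ.≤-trans (decreasing P _) (go r≤s)

-- Parts decrease, so the bound by `inner` passes southeast from `x` to `z`, and the bound by
-- `outer` northwest from `y` to `z`.
convex : ∀ D → x ∈ᵈ D → y ∈ᵈ D → x ⊑ z → z ⊑ y → z ∈ᵈ D
convex D (μ≤x , _) (_ , y<λ) (rx≤rz , cx≤cz) (rz≤ry , cz≤cy) =
  ℕ.≤-trans (antitone (inner D) rx≤rz) (ℕ.≤-trans μ≤x cx≤cz) ,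
  ℕ.≤-trans (s≤s cz≤cy) (ℕ.≤-trans y<λ (antitone (outer D) rz≤ry))

_∈ᵈ?_ : ∀ x D → Dec (x ∈ᵈ D)
x ∈ᵈ? D = (part (inner D) (row x) ℕ.≤? col x) ×-dec (col x ℕ.<? part (outer D) (row x))

2×2-of-⊏ : ∀ D → x ∈ᵈ D → y ∈ᵈ D → x ⊏ y → Contains2×2 D
2×2-of-⊏ {x@(box r c)} {y} D x∈ y∈ (r<s , c<t) = r , c , x∈ ,
  convex D x∈ y∈ (ℕ.≤-refl , ℕ.n≤1+n c) (ℕ.<⇒≤ r<s , c<t) ,
  convex D x∈ y∈ (ℕ.n≤1+n r , ℕ.≤-refl) (r<s , ℕ.<⇒≤ c<t) ,
  convex D x∈ y∈ (ℕ.n≤1+n r , ℕ.n≤1+n c) (r<s , c<t)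

-- Border strips: one box per content, one step between contents.

module _ (bs : IsBorderStrip θ) where
  open IsBorderStrip bs

  content-injective : x ∈ᵈ θ → y ∈ᵈ θ → content x ≡ content y → x ≡ y
  content-injective x∈ y∈ eq with compare-diagonal eq
  ... | inj₁ x⊏y        = contradiction (2×2-of-⊏ θ x∈ y∈ x⊏y) no2×2
  ... | inj₂ (inj₁ x≡y) = x≡y
  ... | inj₂ (inj₂ y⊏x) = contradiction (2×2-of-⊏ θ y∈ x∈ y⊏x) no2×2

  -- A path from content ≤ j to content > j has a step from content j to j + 1.
  crossing : x ∈ᵈ θ → y ∈ᵈ θ → content x ≤ j → j < content y → ∃ λ d → Goes d θ j
  crossing {j = j} x∈ y∈ = go (connected x∈ y∈)
    where
    Step : Rel Box 0ℓ
    Step u v = u ∈ᵈ θ × v ∈ᵈ θ × ShareEdge u v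

    direction : ShareEdge u v → ∃ λ d → Next d v u ⊎ Next d u v
    direction (inj₁ e) = north , e
    direction (inj₂ e) = east , e

    step : Step u v → content u ≤ j → j < content v → ∃ λ d → Goes d θ j
    step {u} {v} (u∈ , v∈ , e) u≤j j<v with direction {u} {v} e
    ... | d , inj₁ n = d , u , v , u∈ , v∈ , u≡j , trans v≡u+1 (cong (_+ 1ℤ) u≡j) , n
      where
      v≡u+1 : content v ≡ content u + 1ℤ
      v≡u+1 = Next-content d n
      u≡j : content u ≡ j
      u≡j = ℤ.≤-antisym u≤j (i<j+1⇒i≤j (subst (j <_) v≡u+1 j<v))
    -- A step against its direction lowers the content, so it cannot pass beyond `j`.
    ... | d , inj₂ n = contradiction (ℤ.≤-trans v≤u u≤j) (ℤ.<⇒≱ j<v)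
      where
      v≤u : content v ≤ content u
      v≤u = subst (content v ≤_) (sym (Next-content d n)) (ℤ.<⇒≤ (i<i+1 (content v)))

    go : Star Step u v → content u ≤ j → j < content v → ∃ λ d → Goes d θ j
    go ε u≤j j<u = contradiction u≤j (ℤ.<⇒≱ j<u)
    go (_◅_ {j = w} s p) u≤j j<v with content w ℤ.≤? j
    ... | yes w≤j = go p w≤j j<v
    ... | no  w≰j = step s u≤j (ℤ.≰⇒> w≰j)

Goes⇒Meets : ∀ d → Goes d θ j → Meets θ j
Goes⇒Meets d (x , y , x∈ , y∈ , x≡ , y≡ , _) = (x , x∈ , x≡) , (y , y∈ , y≡)

-- Ends and starts on adjacent diagonals.

-- Inspect the topmost (d = north) or bottommost (d = east) box x of content i: if
-- its neighbour in direction d is in D, then that neighbour is a start, since the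
-- box preceding it in direction flip d would again have content i.
end-or-start : ∀ d D → HasContent D i → HasEnd d D i ⊎ HasStart (flip d) D (i + 1ℤ)
end-or-start {i} north D (box r c , x∈ , refl) = go r c x∈ refl
  where
  go : ∀ r c → box r c ∈ᵈ D → content (box r c) ≡ i →
       HasEnd north D i ⊎ HasStart east D (i + 1ℤ)
  go zero c x∈ x≡ = inj₁ (box zero c , (x∈ , λ { _ (() , _) }) , x≡)
  go (suc r) c x∈ x≡ with box r c ∈ᵈ? D
  ... | no  y∉ = inj₁ (_ , (x∈ , λ { _ (refl , refl) → y∉ }) , x≡)
  go (suc r) zero x∈ x≡ | yes y∈ =
    inj₂ (box r zero , (y∈ , λ { _ (_ , ()) }) ,
          trans (Next-content {x = box (suc r) zero} north (refl , refl)) (cong (_+ 1ℤ) x≡))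
  go (suc r) (suc c) x∈ x≡ | yes y∈ with box r c ∈ᵈ? D
  ... | no  z∉ =
    inj₂ (box r (suc c) , (y∈ , λ { _ (refl , refl) → z∉ }) ,
          trans (Next-content {x = box (suc r) (suc c)} north (refl , refl)) (cong (_+ 1ℤ) x≡))
  ... | yes z∈ = go r c z∈ (trans (lemma (+ c) (+ r)) x≡)
    where
    lemma : ∀ c r → c - r ≡ 1ℤ + c - (1ℤ + r)
    lemma = solve-∀
end-or-start {i} east D (box r c , x∈ , refl) = go n r c (ℕ.m≤m+n n r) x∈ refl
  where
  n : ℕ
  n = proj₁ (eventuallyZero (outer D))

  -- The walk goes southeast with fuel `k`: rows from `n` on are empty, and each step trades one
  -- unit of fuel for one row.
  go : ∀ k r c → n ℕ.≤ k ℕ.+ r → box r c ∈ᵈ D → content (box r c) ≡ i →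
       HasEnd east D i ⊎ HasStart north D (i + 1ℤ)
  go zero r c n≤r (_ , c<λ) x≡ =
    contradiction (subst (c ℕ.<_) (proj₂ (eventuallyZero (outer D)) r n≤r) c<λ) (λ ())
  go (suc k) r c n≤ x∈ x≡ with box r (suc c) ∈ᵈ? D
  ... | no  y∉ = inj₁ (_ , (x∈ , λ { _ (refl , refl) → y∉ }) , x≡)
  ... | yes y∈ with box (suc r) (suc c) ∈ᵈ? D
  ... | no  z∉ =
    inj₂ (_ , (y∈ , λ { _ (refl , refl) → z∉ }) ,
          trans (Next-content {x = box r c} east (refl , refl)) (cong (_+ 1ℤ) x≡))
  ... | yes z∈ = go k (suc r) (suc c) (subst (n ℕ.≤_) (sym (ℕ.+-suc k r)) n≤) z∈
    (trans (lemma (+ c) (+ r)) x≡)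
    where
    lemma : ∀ c r → 1ℤ + c - (1ℤ + r) ≡ c - r
    lemma = solve-∀

-- Whichever way `x` and `y` lie, convexity puts into `D` either the neighbour of `x` in direction
-- `d` or the box that `y` follows in direction `flip d`.
not-end-and-start : ∀ d D → HasEnd d D i → ¬ HasStart (flip d) D (i + 1ℤ)
not-end-and-start north D (x , (x∈ , x-top) , refl) (y , (y∈ , y-left) , y≡)
  with x | y | compare-adjacent {y} {x} y≡
... | box (suc r) c | _ | inj₁ (s≤s s≤r , t≤c) =
  x-top (box r c) (refl , refl)
    (convex D y∈ x∈ (s≤r , t≤c) (ℕ.n≤1+n r , ℕ.≤-refl))
... | _ | box s (suc t) | inj₂ (r≤s , s≤s c≤t) =
  y-left (box s t) (refl , refl)
    (convex D x∈ y∈ (r≤s , c≤t) (ℕ.≤-refl , ℕ.n≤1+n t))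
not-end-and-start east D (x , (x∈ , x-right) , refl) (y , (y∈ , y-bottom) , y≡)
  with compare-adjacent {y} {x} y≡
... | inj₁ (s<r , t≤c) =
  y-bottom (box (suc (row y)) (col y)) (refl , refl)
    (convex D y∈ x∈ (ℕ.n≤1+n _ , ℕ.≤-refl) (s<r , t≤c))
... | inj₂ (r≤s , c<t) =
  x-right (box (row x) (suc (col x))) (refl , refl)
    (convex D x∈ y∈ (ℕ.≤-refl , ℕ.n≤1+n _) (r≤s , c<t))

-- Another box on the diagonal of `x` would by convexity put into `D` either the neighbour of `x` in
-- direction `flip d` or the box that `y` follows in that direction.
lone : ∀ d D → Next d y x → OnEnd (flip d) D x → OnStart (flip d) D y →
  u ∈ᵈ D → content u ≡ content x → u ≡ x
lone {x = x} {u = u} d D n x-end y-start u∈ eq with compare-diagonal eq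
... | inj₂ (inj₁ u≡x) = u≡x
... | inj₁ u⊏x        = ⊥-elim (before d n x-end y-start u⊏x)
  where
  before : ∀ {x y} d → Next d y x → OnEnd (flip d) D x → OnStart (flip d) D y → ¬ u ⊏ x
  before {x = box (suc r) (suc c)} north (refl , refl) _ (y∈ , y-left) (s≤s s≤r , s≤s t≤c) =
    y-left (box r c) (refl , refl)
      (convex D u∈ y∈ (s≤r , t≤c) (ℕ.≤-refl , ℕ.n≤1+n c))
  before {x = box (suc r) c} east (refl , refl) (x∈ , x-top) _ (s≤s s≤r , t<c) =
    x-top (box r c) (refl , refl)
      (convex D u∈ x∈ (s≤r , ℕ.<⇒≤ t<c) (ℕ.n≤1+n r , ℕ.≤-refl))
... | inj₂ (inj₂ x⊏u) = ⊥-elim (after d n x-end y-start x⊏u)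
  where
  after : ∀ {x y} d → Next d y x → OnEnd (flip d) D x → OnStart (flip d) D y → ¬ x ⊏ u
  after {x = box r c} north (refl , refl) (x∈ , x-right) _ (r<s , c<t) =
    x-right (box r (suc c)) (refl , refl)
      (convex D x∈ u∈ (ℕ.≤-refl , ℕ.n≤1+n c) (ℕ.<⇒≤ r<s , c<t))
  after {x = box r c} east (refl , refl) _ (y∈ , y-bottom) (r<s , c<t) =
    y-bottom (box (suc r) (suc c)) (refl , refl)
      (convex D y∈ u∈ (ℕ.n≤1+n r , ℕ.≤-refl) (r<s , c<t))

-- What the cutting strip says about ends and starts of strips.

module Cutting {D cmin cmax} (D-contents : HasContents[ cmin , cmax ] D)
               (Π : OutsideDecomposition D) (cut : IsCuttingStrip cmin cmax Π φ) where
  private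
    module Φ = IsCuttingStrip cut
    S = strip Π

  Term⇒HasContent : Term Π j → HasContent D j
  Term⇒HasContent (k , x , (x∈ , _) , x≡) = x , within Π k x x∈ , x≡

  Init⇒HasContent : Init Π j → HasContent D j
  Init⇒HasContent (k , x , (x∈ , _) , x≡) = x , within Π k x x∈ , x≡

  -- The cutting strip makes no step from `cmax` and none into `cmin`, so these two contents are
  -- settled directly.
  cmax∈Term : cmin ≤ cmax → cmax ∈ Term Π
  cmax∈Term c≤ with from (D-contents cmax) (c≤ , ℤ.≤-refl)
  ... | x , x∈ , x≡ with covers Π x x∈
  ... | k , x∈k = k , x , (x∈k , λ y y∈ → subst (content y ≤_) (sym x≡)
    (proj₂ (to (D-contents _) (y , within Π k y y∈ , refl)))) , x≡

  cmin∈Init : cmin ≤ cmax → cmin ∈ Init Π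
  cmin∈Init c≤ with from (D-contents cmin) (ℤ.≤-refl , c≤)
  ... | x , x∈ , x≡ with covers Π x x∈
  ... | k , x∈k = k , x , (x∈k , λ y y∈ → subst (_≤ content y) (sym x≡)
    (proj₁ (to (D-contents _) (y , within Π k y y∈ , refl)))) , x≡

  module _ (c≤j : cmin ≤ j) (j<c : j < cmax) where

    goes : ∃ λ d → Goes d φ j
    goes with from (Φ.contents j) (c≤j , ℤ.<⇒≤ j<c)
            | from (Φ.contents (j + 1ℤ)) (ℤ.≤-trans c≤j (ℤ.<⇒≤ (i<i+1 j)) , i<j⇒i+1≤j j<c)
    ... | x , x∈ , x≡ | y , y∈ , y≡ =
      crossing Φ.isBorderStrip x∈ y∈ (ℤ.≤-reflexive x≡) (subst (j <_) (sym y≡) (i<i+1 j))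

    Goes-strip : ∀ d → Goes d φ j → ∀ k → Meets (S k) j → Goes d (S k) j
    Goes-strip north g k m = to (Φ.up    j c≤j j<c (k , m)) g k m
    Goes-strip east  g k m = to (Φ.right j c≤j j<c (k , m)) g k m

    Goes-separated : ∀ d → Goes d φ j → ¬ (∃ λ k → Meets (S k) j) → Goes (flip d) D j
    Goes-separated north g ¬m = to (proj₁ (Φ.separated j c≤j j<c ¬m)) g
    Goes-separated east  g ¬m = to (proj₂ (Φ.separated j c≤j j<c ¬m)) g

    module _ d (g : Goes d φ j) where

      -- Crossing shows that the strip meets `j`, the cutting strip then makes `d` the direction of
      -- the step, and the step starts at `x`, the only box of content `j` in the strip.
      successor : ∀ k → x ∈ᵈ S k → content x ≡ j → z ∈ᵈ S k → j < content z →
        ∃ λ y → y ∈ᵈ S k × Next d y x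
      successor {x} k x∈ x≡ z∈ j<z
        with crossing (isBorderStrip Π k) x∈ z∈ (ℤ.≤-reflexive x≡) j<z
      ... | e , h with Goes-strip d g k (Goes⇒Meets {S k} e h)
      ... | u , v , u∈ , v∈ , u≡ , _ , n = v , v∈ , subst (Next d v)
        (content-injective (isBorderStrip Π k) u∈ x∈ (trans u≡ (sym x≡))) n

      predecessor : ∀ k → y ∈ᵈ S k → content y ≡ j + 1ℤ → z ∈ᵈ S k → content z ≤ j →
        ∃ λ x → x ∈ᵈ S k × Next d y x
      predecessor {y} k y∈ y≡ z∈ z≤j
        with crossing (isBorderStrip Π k) z∈ y∈ z≤j (subst (j <_) (sym y≡) (i<i+1 j))
      ... | e , h with Goes-strip d g k (Goes⇒Meets {S k} e h)
      ... | u , v , u∈ , v∈ , _ , v≡ , n = u , u∈ , subst (λ w → Next d w u)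
        (content-injective (isBorderStrip Π k) v∈ y∈ (trans v≡ (sym y≡))) n

      terminal : ∀ k → x ∈ᵈ S k → content x ≡ j → (∀ y → Next d y x → ¬ (y ∈ᵈ S k)) →
        IsTerminal (S k) x
      terminal {x} k x∈ x≡ none = x∈ , bound
        where
        bound : ∀ z → z ∈ᵈ S k → content z ≤ content x
        bound z z∈ with content z ℤ.≤? content x
        ... | yes z≤x = z≤x
        ... | no  z≰x with successor k x∈ x≡ z∈ (subst (_< content z) x≡ (ℤ.≰⇒> z≰x))
        ... | y , y∈ , n = contradiction y∈ (none y n)

      initial : ∀ k → y ∈ᵈ S k → content y ≡ j + 1ℤ → (∀ x → Next d y x → ¬ (x ∈ᵈ S k)) →
        IsInitial (S k) y
      initial {y} k y∈ y≡ none = y∈ , bound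
        where
        bound : ∀ z → z ∈ᵈ S k → content y ≤ content z
        bound z z∈ with content y ℤ.≤? content z
        ... | yes y≤z = y≤z
        ... | no  y≰z with predecessor k y∈ y≡ z∈
                             (i<j+1⇒i≤j (subst (content z <_) y≡ (ℤ.≰⇒> y≰z)))
        ... | x , x∈ , n = contradiction x∈ (none x n)

      private
        end-side : ∀ d → OnRight D x ⊎ OnTop D x → OnEnd d D x ⊎ OnEnd (flip d) D x
        end-side north = swap
        end-side east  = id

        start-side : ∀ d → OnLeft D x ⊎ OnBottom D x → OnStart d D x ⊎ OnStart (flip d) D x
        start-side north = swap
        start-side east  = id

      -- If x and y were in different strips, x would end and y start a strip, so
      -- the perimeter conditions make them the only boxes of contents j and j + 1.
      -- No strip then meets j, and the convention for separated boxes says that D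
      -- goes in direction flip d at j.
      linked : x ∈ᵈ D → y ∈ᵈ D → content x ≡ j → Next d y x → ∃ λ k → x ∈ᵈ S k × y ∈ᵈ S k
      linked {x} {y} x∈ y∈ x≡ n with covers Π x x∈ | covers Π y y∈
      ... | k , x∈k | l , y∈l with k Fin.≟ l
      ... | yes refl = k , x∈k , y∈l
      ... | no  k≢l  = ⊥-elim (contra (end-side d (ends Π k x x-term)) (start-side d (starts Π l y y-init)))
        where
        y≡ : content y ≡ j + 1ℤ
        y≡ = trans (Next-content d n) (cong (_+ 1ℤ) x≡)

        x-term : IsTerminal (S k) x
        x-term = terminal k x∈k x≡ λ y′ n′ y′∈k → k≢l
          (disjoint Π k l y (subst (_∈ᵈ S k) (Next-functional d n′ n) y′∈k) y∈l)

        y-init : IsInitial (S l) y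
        y-init = initial l y∈l y≡ λ x′ n′ x′∈l → k≢l
          (disjoint Π k l x x∈k (subst (_∈ᵈ S l) (Next-injective d n′ n) x′∈l))

        contra : OnEnd d D x ⊎ OnEnd (flip d) D x → OnStart d D y ⊎ OnStart (flip d) D y → ⊥
        -- In direction `d` the boxes `x` and `y` are neighbours in `D`, so only perimeter
        -- conditions in direction `flip d` survive.
        contra (inj₁ (_ , x-end)) _ = x-end y n y∈
        contra (inj₂ _) (inj₁ (_ , y-start)) = y-start x n x∈
        contra (inj₂ x-end) (inj₂ y-start) = D-not-flip (Goes-separated d g unmet)
          where
          only : u ∈ᵈ D → content u ≡ j → u ≡ x
          only u∈ u≡ = lone d D n x-end y-start u∈ (trans u≡ (sym x≡))

          unmet : ¬ (∃ λ m → Meets (S m) j)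
          -- The step of such a strip starts at `x`, hence ends at `y`, and the strip would equal
          -- both `S k` and `S l`.
          unmet (m , meets) with Goes-strip d g m meets
          ... | u , v , u∈ , v∈ , u≡ , _ , n′ with only (within Π m u u∈) u≡
          ... | refl with Next-functional d n′ n
          ... | refl = k≢l (trans (disjoint Π k m x x∈k u∈) (disjoint Π m l y v∈ y∈l))

          D-not-flip : ¬ Goes (flip d) D j
          D-not-flip (u , v , u∈ , v∈ , u≡ , _ , n′) with only u∈ u≡
          ... | refl = proj₂ x-end v n′ v∈

      -- By `linked`, a neighbour in direction `d` inside `D` continues the strip; without one the
      -- strip has to stop.
      Term⇔HasEnd : Term Π j ⇔ HasEnd d D j
      Term⇔HasEnd = mk⇔ ⇒ ⇐
        where
        ⇒ : Term Π j → HasEnd d D j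
        ⇒ (k , x , (x∈ , x-max) , x≡) = x , (within Π k x x∈ , none) , x≡
          where
          none : ∀ y → Next d y x → ¬ (y ∈ᵈ D)
          none y n y∈ with linked (within Π k x x∈) y∈ x≡ n
          ... | l , x∈l , y∈l with disjoint Π l k x x∈l x∈
          ... | refl = ℤ.<⇒≱ (i<i+1 (content x))
            (subst (_≤ content x) (Next-content d n) (x-max y y∈l))
        ⇐ : HasEnd d D j → Term Π j
        ⇐ (x , (x∈ , x-end) , x≡) with covers Π x x∈
        ... | k , x∈k = k , x , terminal k x∈k x≡ (λ y n → x-end y n ∘ within Π k y) , x≡

      Init⇔HasStart : Init Π (j + 1ℤ) ⇔ HasStart d D (j + 1ℤ)
      Init⇔HasStart = mk⇔ ⇒ ⇐
        where
        ⇒ : Init Π (j + 1ℤ) → HasStart d D (j + 1ℤ)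
        ⇒ (k , y , (y∈ , y-min) , y≡) = y , (within Π k y y∈ , none) , y≡
          where
          none : ∀ x → Next d y x → ¬ (x ∈ᵈ D)
          none x n x∈ with linked x∈ (within Π k y y∈)
                             (+1-injective (trans (sym (Next-content d n)) y≡)) n
          ... | l , x∈l , y∈l with disjoint Π l k y y∈l y∈
          ... | refl = ℤ.<⇒≱ (i<i+1 (content x))
            (subst (_≤ content x) (Next-content d n) (y-min x x∈l))
        ⇐ : HasStart d D (j + 1ℤ) → Init Π (j + 1ℤ)
        ⇐ (y , (y∈ , y-start) , y≡) with covers Π y y∈
        ... | k , y∈k = k , y , initial k y∈k y≡ (λ x n → y-start x n ∘ within Π k x) , y≡

-- Decompositions whose cutting strips agree at one content.

module _ {D cmin cmax} (D-contents : HasContents[ cmin , cmax ] D)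
         (Π Π′ : OutsideDecomposition D)
         (cut : IsCuttingStrip cmin cmax Π φ) (cut′ : IsCuttingStrip cmin cmax Π′ φ′) where
  private
    module C  = Cutting D-contents Π cut
    module C′ = Cutting D-contents Π′ cut′

  Term-agree : (∀ d → Goes d φ j → Goes d φ′ j) → j ∈ Term Π → j ∈ Term Π′
  Term-agree {j} same t with to (D-contents j) (C.Term⇒HasContent t)
  ... | c≤j , j≤c with j ℤ.≟ cmax
  ... | yes refl = C′.cmax∈Term c≤j
  ... | no  j≢c with ℤ.≤∧≢⇒< j≤c j≢c
  ... | j<c with C.goes c≤j j<c
  ... | d , g = from (C′.Term⇔HasEnd c≤j j<c d (same d g)) (to (C.Term⇔HasEnd c≤j j<c d g) t)

  -- The direction at `j` governs the starts of content `j + 1`; only `j + 1 ≡ cmin` has no such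
  -- direction.
  Init-agree : (∀ d → Goes d φ j → Goes d φ′ j) → j + 1ℤ ∈ Init Π → j + 1ℤ ∈ Init Π′
  Init-agree {j} same t with to (D-contents (j + 1ℤ)) (C.Init⇒HasContent t)
  ... | c≤p , p≤c with cmin ℤ.≟ j + 1ℤ
  ... | yes refl = C′.cmin∈Init p≤c
  ... | no  c≢p with i<j+1⇒i≤j (ℤ.≤∧≢⇒< c≤p c≢p) | ℤ.<-≤-trans (i<i+1 j) p≤c
  ... | c≤j | j<c with C.goes c≤j j<c
  ... | d , g = from (C′.Init⇔HasStart c≤j j<c d (same d g)) (to (C.Init⇔HasStart c≤j j<c d g) t)

-- Sets of integers that agree away from one point.

module _ {A B : Pred ℤ 0ℓ} {a : ℤ} (off : ∀ {j} → j ≢ a → j ∈ A ⇔ j ∈ B) where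

  ≐-∪ : a ∈ B → B ≐ A ∪ ｛ a ｝
  ≐-∪ a∈B = there , [ back , (λ { refl → a∈B }) ]′
    where
    there : ∀ {j} → j ∈ B → j ∈ A ⊎ a ≡ j
    there {j} j∈B with a ℤ.≟ j
    ... | yes a≡j = inj₂ a≡j
    ... | no  a≢j = inj₁ (from (off (a≢j ∘ sym)) j∈B)
    back : ∀ {j} → j ∈ A → j ∈ B
    back {j} j∈A with a ℤ.≟ j
    ... | yes refl = a∈B
    ... | no  a≢j  = to (off (a≢j ∘ sym)) j∈A

  ≐-∖ : a ∉ B → B ≐ A ∖ ｛ a ｝
  ≐-∖ a∉B =
    (λ j∈B → let a≢j = λ { refl → a∉B j∈B } in from (off (a≢j ∘ sym)) j∈B , a≢j) ,
    (λ { (j∈A , a≢j) → to (off (a≢j ∘ sym)) j∈A })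

  ≐-same : (a ∈ A ⇔ a ∈ B) → B ≐ A
  ≐-same at = from (everywhere _) , to (everywhere _)
    where
    everywhere : ∀ j → j ∈ A ⇔ j ∈ B
    everywhere j with j ℤ.≟ a
    ... | yes refl = at
    ... | no  j≢a  = off j≢a

-- Four cases told apart by two decidable statements.

module _ {P Q A B C E : Set} where

  cases : Vec Set 4
  cases = (¬ P × ¬ Q × A) ∷ (P × Q × B) ∷ (P × ¬ Q × C) ∷ (¬ P × Q × E) ∷ []

  -- The signs of `P` and `Q` already make the cases exclusive; the last component only has to
  -- follow from its own sign pattern.
  exactlyOne : Dec P → Dec Q →
    (¬ P → ¬ Q → A) → (P → Q → B) → (P → ¬ Q → C) → (¬ P → Q → E) → ExactlyOne cases
  exactlyOne (no ¬p) (no ¬q) a _ _ _ = zero , (¬p , ¬q , a ¬p ¬q) , unique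
    where
    unique : ∀ {m} → lookup cases m → zero ≡ m
    unique {zero}                 _ = refl
    unique {suc zero}             (p , _) = contradiction p ¬p
    unique {suc (suc zero)}       (p , _) = contradiction p ¬p
    unique {suc (suc (suc zero))} (_ , q , _) = contradiction q ¬q
  exactlyOne (yes p) (yes q) _ b _ _ = suc zero , (p , q , b p q) , unique
    where
    unique : ∀ {m} → lookup cases m → suc zero ≡ m
    unique {zero}                 (¬p , _) = contradiction p ¬p
    unique {suc zero}             _ = refl
    unique {suc (suc zero)}       (_ , ¬q , _) = contradiction q ¬q
    unique {suc (suc (suc zero))} (¬p , _) = contradiction p ¬p
  exactlyOne (yes p) (no ¬q) _ _ c _ = suc (suc zero) , (p , ¬q , c p ¬q) , unique
    where
    unique : ∀ {m} → lookup cases m → suc (suc zero) ≡ m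
    unique {zero}                 (¬p , _) = contradiction p ¬p
    unique {suc zero}             (_ , q , _) = contradiction q ¬q
    unique {suc (suc zero)}       _ = refl
    unique {suc (suc (suc zero))} (¬p , _) = contradiction p ¬p
  exactlyOne (no ¬p) (yes q) _ _ _ e = suc (suc (suc zero)) , (¬p , q , e ¬p q) , unique
    where
    unique : ∀ {m} → lookup cases m → suc (suc (suc zero)) ≡ m
    unique {zero}                 (_ , ¬q , _) = contradiction q ¬q
    unique {suc zero}             (p , _) = contradiction p ¬p
    unique {suc (suc zero)}       (p , _) = contradiction p ¬p
    unique {suc (suc (suc zero))} _ = refl

theorem2p2 : (D : SkewDiagram) → EdgewiseConnected D →
    (cmin cmax : ℤ) → HasContents[ cmin , cmax ] D →
    (i : ℤ) → cmin ≤ i → i < cmax →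
    (Π Π′ : OutsideDecomposition D) → IsTwist cmin cmax i Π Π′ →
    ExactlyOne
    ( (i ∉ Term Π × i + 1ℤ ∉ Init Π × Init Π′ ≐ Init Π ∪ ｛ i + 1ℤ ｝ × Term Π′ ≐ Term Π ∪ ｛ i ｝)
    ∷ (i ∈ Term Π × i + 1ℤ ∈ Init Π × Init Π′ ≐ Init Π ∖ ｛ i + 1ℤ ｝ × Term Π′ ≐ Term Π ∖ ｛ i ｝)
    ∷ (i ∈ Term Π × i + 1ℤ ∉ Init Π × Init Π′ ≐ Init Π × Term Π′ ≐ Term Π)
    ∷ (i ∉ Term Π × i + 1ℤ ∈ Init Π × Init Π′ ≐ Init Π × Term Π′ ≐ Term Π)
    ∷ [] )
theorem2p2 D _ cmin cmax D-contents i c≤i i<c Π Π′ (φ , φ′ , cut , cut′ , switch) =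
  exactlyOne T? I?
    (λ ¬T ¬I → ≐-∪ Init-off (¬T⇒I′ ¬T) , ≐-∪ Term-off (¬I⇒T′ ¬I))
    (λ T I   → ≐-∖ Init-off (T⇒¬I′ T) , ≐-∖ Term-off (I⇒¬T′ I))
    -- Here `i + 1` starts no strip of either decomposition, while `i` ends one in both.
    (λ T ¬I  → ≐-same Init-off (mk⇔ (⊥-elim ∘ ¬I) (⊥-elim ∘ T⇒¬I′ T)) ,
               ≐-same Term-off (mk⇔ (λ _ → ¬I⇒T′ ¬I) (λ _ → T)))
    (λ ¬T I  → ≐-same Init-off (mk⇔ (λ _ → ¬T⇒I′ ¬T) (λ _ → I)) ,
               ≐-same Term-off (mk⇔ (⊥-elim ∘ ¬T) (⊥-elim ∘ I⇒¬T′ I)))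
  where
  module C  = Cutting D-contents Π cut
  module C′ = Cutting D-contents Π′ cut′
  module W  = IsSwitch switch

  Goes-else : ∀ {j} → j ≢ i → ∀ d → Goes d φ′ j ⇔ Goes d φ j
  Goes-else j≢i north = W.up-else _ j≢i
  Goes-else j≢i east  = W.right-else _ j≢i

  Goes-at-i : ∀ d → Goes d φ i → Goes (flip d) φ′ i
  Goes-at-i north = from W.right-at-i
  Goes-at-i east  = from W.up-at-i

  d : Direction
  d = proj₁ (C.goes c≤i i<c)

  g : Goes d φ i
  g = proj₂ (C.goes c≤i i<c)

  flip² : ∀ d → flip (flip d) ≡ d
  flip² north = refl
  flip² east  = refl

  T⇔ : i ∈ Term Π ⇔ HasEnd d D i
  T⇔ = C.Term⇔HasEnd c≤i i<c d g
  T′⇔ : i ∈ Term Π′ ⇔ HasEnd (flip d) D i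
  T′⇔ = C′.Term⇔HasEnd c≤i i<c (flip d) (Goes-at-i d g)
  -- Written with `flip (flip d)` so that the dichotomy for `flip d` applies as it stands.
  I⇔ : i + 1ℤ ∈ Init Π ⇔ HasStart (flip (flip d)) D (i + 1ℤ)
  I⇔ = subst (λ e → i + 1ℤ ∈ Init Π ⇔ HasStart e D (i + 1ℤ)) (sym (flip² d))
    (C.Init⇔HasStart c≤i i<c d g)
  I′⇔ : i + 1ℤ ∈ Init Π′ ⇔ HasStart (flip d) D (i + 1ℤ)
  I′⇔ = C′.Init⇔HasStart c≤i i<c (flip d) (Goes-at-i d g)

  one : ∀ d → HasEnd d D i ⊎ HasStart (flip d) D (i + 1ℤ)
  one d = end-or-start d D (from (D-contents i) (c≤i , ℤ.<⇒≤ i<c))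

  T⇒¬I′ : i ∈ Term Π → i + 1ℤ ∉ Init Π′
  T⇒¬I′ t = not-end-and-start d D (to T⇔ t) ∘ to I′⇔

  I⇒¬T′ : i + 1ℤ ∈ Init Π → i ∉ Term Π′
  I⇒¬T′ s t = not-end-and-start (flip d) D (to T′⇔ t) (to I⇔ s)

  ¬T⇒I′ : i ∉ Term Π → i + 1ℤ ∈ Init Π′
  ¬T⇒I′ ¬t = [ ⊥-elim ∘ ¬t ∘ from T⇔ , from I′⇔ ]′ (one d)

  ¬I⇒T′ : i + 1ℤ ∉ Init Π → i ∈ Term Π′
  ¬I⇒T′ ¬s = [ from T′⇔ , ⊥-elim ∘ ¬s ∘ from I⇔ ]′ (one (flip d))

  -- The dichotomy is constructive: its second alternative makes `i + 1` initial in `Π′`, which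
  -- refutes `i ∈ Term Π`.
  T? : Dec (i ∈ Term Π)
  T? = [ yes ∘ from T⇔ , (λ s → no λ t → T⇒¬I′ t (from I′⇔ s)) ]′ (one d)

  I? : Dec (i + 1ℤ ∈ Init Π)
  I? = [ (λ t → no λ s → I⇒¬T′ s (from T′⇔ t)) , yes ∘ from I⇔ ]′ (one (flip d))

  Term-off : ∀ {j} → j ≢ i → j ∈ Term Π ⇔ j ∈ Term Π′
  Term-off j≢i = mk⇔
    (Term-agree D-contents Π Π′ cut cut′ (λ d → from (Goes-else j≢i d)))
    (Term-agree D-contents Π′ Π cut′ cut (λ d → to (Goes-else j≢i d)))

  Init-off : ∀ {p} → p ≢ i + 1ℤ → p ∈ Init Π ⇔ p ∈ Init Π′
  -- Starts of content `p` are governed by the direction at `pred p`.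
  Init-off {p} p≢ = subst (λ p → p ∈ Init Π ⇔ p ∈ Init Π′) (pred+1 p) (mk⇔
    (Init-agree D-contents Π Π′ cut cut′ (λ d → from (Goes-else pred≢i d)))
    (Init-agree D-contents Π′ Π cut′ cut (λ d → to (Goes-else pred≢i d))))
    where
    pred≢i : pred p ≢ i
    pred≢i eq = p≢ (trans (sym (pred+1 p)) (cong (_+ 1ℤ) eq))
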